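{- Let $p$ be an odd prime and suppose that $x,y,z$ are positive integers with $|x-y|=1$ and $$p^x+(2p+1)^y=z^2.$$ Then exactly one of the following holds. (i) $(x,y,z)=(2,1,p+1)$. (ii) The integer $2p+1$ is composite, and there exist integers $k\ge 2$, $a\ge 1$ and $b\ge 0$ with $x=2a$ and $y=2b+1$ such that $p=2k^2-1$, $2p+1=(2k-1)(2k+1)$ with $\gcd(2k-1,2k+1)=1$, $$(2k+1)^{2b+1}-(2k-1)^{2b+1}=2(2k^2-1)^a,$$ and $b<\lceil \log_2(2k^2-1)\rceil$. -}

module Defs where

open import Data.Product using (_×_)
open import Data.Sum using (_⊎_)
open import Level using (Level; _⊔_)
open import Relation.Nullary using (¬_)

private
  variable
    a b : Level

ExactlyOne : Set a → Set b → Set (a ⊔ b)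
ExactlyOne P Q = (P ⊎ Q) × ¬ (P × Q)

{-# OPTIONS --safe #-}
module Submission where

-- Write q = 2p + 1.  One exponent is even, so its power is a square w² and
-- the other base r (p or q) satisfies rⁿ = (z - w)(z + w) with
-- coprime factors; hence z - w = dⁿ, z + w = eⁿ and d e = r.
-- If y is even, then r = p forces d = 1, so 1 + 2 q^b = pⁿ; modulo p this gives
-- p = 3, and then 3 would be a square modulo 7.
-- If y is odd, then eʸ - dʸ = 2pᵃ and e - d divides 2pᵃ.  Either d = 1, where
-- comparing sizes gives y = 1, or e < p + 1, where e - d = 2, so d = 2k - 1.
-- The bound on b comes from (2p)^b ≤ (d e)^b ≤ pᵃ ≤ p^(b + 1).

open import Defs
open import Data.Nat using (ℕ; zero; suc; _+_; _*_; _∸_; _^_; _≤_; _<_; ∣_-_∣; z≤n; s≤s; s≤s⁻¹; NonZero; ⌈_/2⌉; _%_; >-nonZero; ≢-nonZero; ≢-nonZero⁻¹; nonTrivial⇒n>1; n>1⇒nonTrivial)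
open import Data.Nat.Coprimality using (Coprime; GCD≡1⇒coprime; coprime⇒gcd≡1; coprime-divisor; coprime-factors; prime⇒coprime)
import Data.Nat.Coprimality as Coprimality
open import Data.Nat.DivMod using ([m+kn]%n≡m%n)
open import Data.Nat.Divisibility
open import Data.Nat.GCD using (gcd; gcd[m,n]∣m; gcd[m,n]∣n; gcd[m,n]≢0; gcd-GCD; GCD-*; module GCD)
open import Data.Nat.Logarithm using (⌈log₂_⌉; ⌈log₂⌉-mono-≤; ⌈log₂⌈n/2⌉⌉≡⌈log₂n⌉∸1)
open import Data.Nat.Primality using (Prime; Composite; composite; prime⇒nonTrivial; prime⇒nonZero; prime⇒irreducible)
open import Data.Nat.Properties
open import Data.Nat.Tactic.RingSolver using (solve-∀)
open import Data.Product using (_×_; _,_; ∃-syntax)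
open import Data.Sum using (_⊎_; inj₁; inj₂; [_,_])
open import Relation.Binary.PropositionalEquality using (_≡_; _≢_; refl; sym; trans; cong; cong₂; subst; module ≡-Reasoning)
open import Relation.Nullary using (¬_; contradiction)

-- Powers and coprimality.

^-distribʳ-* : ∀ m n k → (m * n) ^ k ≡ m ^ k * n ^ k
^-distribʳ-* m n zero    = refl
^-distribʳ-* m n (suc k) = trans (cong (m * n *_) (^-distribʳ-* m n k))
                                 (interchange m n (m ^ k) (n ^ k))
  where
  interchange : ∀ a b c d → a * b * (c * d) ≡ a * c * (b * d)
  interchange = solve-∀

^-even : ∀ m k → m ^ (2 * k) ≡ m ^ k * m ^ k
^-even m k = trans (cong (λ l → m ^ (k + l)) (+-identityʳ k)) (^-distribˡ-+-* m k k)

^-odd : ∀ m k → m ^ (2 * k + 1) ≡ m * (m ^ k * m ^ k)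
^-odd m k = trans (cong (m ^_) (+-comm (2 * k) 1)) (cong (m *_) (^-even m k))

^-reflects-< : ∀ m n k → m ^ k < n ^ k → m < n
^-reflects-< m n k lt = ≰⇒> λ n≤m → <⇒≱ lt (^-monoˡ-≤ k n≤m)

-- The binomial theorem modulo `n`, with an explicit quotient `t`.
[m+n]^k≡m^k+n*t : ∀ m n k → ∃[ t ] (m + n) ^ k ≡ m ^ k + n * t
[m+n]^k≡m^k+n*t m n zero    = 0 , cong suc (sym (*-zeroʳ n))
[m+n]^k≡m^k+n*t m n (suc k) with [m+n]^k≡m^k+n*t m n k
... | t , eq = (m ^ k + (m + n) * t) , trans (cong ((m + n) *_) eq) (expand m n (m ^ k) t)
  where
  expand : ∀ m n c t → (m + n) * (c + n * t) ≡ m * c + n * (c + (m + n) * t)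
  expand = solve-∀

coprime-* : ∀ {m n k} → Coprime m k → Coprime n k → Coprime (m * n) k
coprime-* m⊥k n⊥k (d∣mn , d∣k) =
  n⊥k (coprime-divisor (λ (c∣d , c∣m) → m⊥k (c∣m , ∣-trans c∣d d∣k)) d∣mn , d∣k)

coprime-^ˡ : ∀ {m k} n → Coprime m k → Coprime (m ^ n) k
coprime-^ˡ zero    m⊥k = Coprimality.1-coprimeTo _
coprime-^ˡ (suc n) m⊥k = coprime-* m⊥k (coprime-^ˡ n m⊥k)

coprime-^ʳ : ∀ {m k} n → Coprime m k → Coprime m (k ^ n)
coprime-^ʳ n m⊥k = Coprimality.sym (coprime-^ˡ n (Coprimality.sym m⊥k))

coprime-multiple+1 : ∀ {m n} → m ∣ n → Coprime m (n + 1)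
coprime-multiple+1 m∣n (d∣m , d∣n+1) = ∣1⇒≡1 (∣m+n∣m⇒∣n d∣n+1 (∣-trans d∣m m∣n))

-- Coprime factors of a perfect power and differences of squares.

-- Take `d = gcd u q` and write `u = u′ * d`, `q = q′ * d`. Then `u` divides both `u ^ n` and
-- `q ^ n`, and after removing `d ^ n` these are coprime, so `u` divides `d ^ n`. Conversely `d ^ n`
-- divides `u * v` and is coprime to `v`.
coprime-factors-of-power : ∀ {u v} q .{{_ : NonZero q}} n → Coprime u v → u * v ≡ q ^ n →
  ∃[ d ] ∃[ e ] q ≡ d * e × u ≡ d ^ n × v ≡ e ^ n
-- For exponent 0 both factors are 1, so the factorization `1 * q` serves.
coprime-factors-of-power {u} {v} q zero u⊥v uv≡1 =
  1 , q , sym (*-identityˡ q) , m*n≡1⇒m≡1 u v uv≡1 , m*n≡1⇒n≡1 u v uv≡1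
coprime-factors-of-power {u} {v} q n@(suc _) u⊥v uv≡qⁿ
  with gcd[m,n]∣m u q | gcd[m,n]∣n u q | gcd-GCD u q
... | divides u′ u≡u′d | divides q′ q≡q′d | isGCD =
  d , q′ , trans q≡q′d (*-comm q′ d) , u≡dⁿ , v≡q′ⁿ
  where
  d = gcd u q

  instance
    d≢0 : NonZero d
    d≢0 = ≢-nonZero (gcd[m,n]≢0 u q (inj₂ (≢-nonZero⁻¹ q)))

    dⁿ≢0 : NonZero (d ^ n)
    dⁿ≢0 = m^n≢0 d n

  u′⊥q′ : Coprime u′ q′
  u′⊥q′ = GCD≡1⇒coprime (GCD-* {c = d} (subst (GCD.GCD (u′ * d) (q′ * d)) (sym (*-identityˡ d))
    (subst (λ w → GCD.GCD w (q′ * d) d) u≡u′d (subst (λ w → GCD.GCD u w d) q≡q′d isGCD))))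

  split : ∀ m m′ → m ≡ m′ * d → m ^ n ≡ m′ ^ n * d ^ n
  split _ m′ m≡m′d = trans (cong (_^ n) m≡m′d) (^-distribʳ-* m′ d n)

  u∣dⁿ : u ∣ d ^ n
  u∣dⁿ = coprime-factors (coprime-^ˡ n (coprime-^ʳ n u′⊥q′))
    ( subst (u ∣_) (split u u′ u≡u′d) (m∣m*n _)
    , subst (u ∣_) (trans uv≡qⁿ (split q q′ q≡q′d)) (m∣m*n v))

  dⁿ∣u : d ^ n ∣ u
  dⁿ∣u = coprime-divisor
    (coprime-^ˡ n λ (c∣d , c∣v) → u⊥v (∣-trans c∣d (gcd[m,n]∣m u q) , c∣v))
    (subst (d ^ n ∣_) (trans (sym (trans uv≡qⁿ (split q q′ q≡q′d))) (*-comm u v)) (n∣m*n (q′ ^ n)))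

  u≡dⁿ : u ≡ d ^ n
  u≡dⁿ = ∣-antisym u∣dⁿ dⁿ∣u

  v≡q′ⁿ : v ≡ q′ ^ n
  v≡q′ⁿ = *-cancelʳ-≡ v (q′ ^ n) (d ^ n) (begin
    v * d ^ n       ≡⟨ cong (v *_) u≡dⁿ ⟨
    v * u           ≡⟨ *-comm v u ⟩
    u * v           ≡⟨ uv≡qⁿ ⟩
    q ^ n           ≡⟨ split q q′ q≡q′d ⟩
    q′ ^ n * d ^ n  ∎)
    where open ≡-Reasoning

m*m≤n^2⇒m≤n : ∀ m n → m * m ≤ n ^ 2 → m ≤ n
m*m≤n^2⇒m≤n m n m²≤n² = ≮⇒≥ λ n<m → <⇒≱ (*-mono-< n<m n<m)
  (subst (m * m ≤_) (cong (n *_) (*-identityʳ n)) m²≤n²)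

-- With `u = z - w` and `v = z + w`, a common divisor of `u` and `v` divides both `2 * w` and
-- `u * v = q ^ n`, hence is 1. The larger factor is kept as `u + 2 * w`.
square-minus-power : ∀ w z q .{{_ : NonZero q}} n → Coprime (2 * w) q →
  w * w + q ^ n ≡ z ^ 2 →
  ∃[ d ] ∃[ e ] q ≡ d * e × z ≡ d ^ n + w × d ^ n + 2 * w ≡ e ^ n
square-minus-power w z q n 2w⊥q eq =
  let d , e , q≡de , u≡dⁿ , v≡eⁿ = coprime-factors-of-power q n u⊥v uv≡qⁿ
  in d , e , q≡de
   , trans (sym (m∸n+n≡m w≤z)) (cong (_+ w) u≡dⁿ)
   , trans (cong (_+ 2 * w) (sym u≡dⁿ)) v≡eⁿ
  where
  u v : ℕ
  u = z ∸ w
  v = u + 2 * w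

  w≤z : w ≤ z
  w≤z = m*m≤n^2⇒m≤n w z (subst (w * w ≤_) eq (m≤m+n (w * w) (q ^ n)))

  uv≡qⁿ : u * v ≡ q ^ n
  uv≡qⁿ = +-cancelˡ-≡ (w * w) (u * v) (q ^ n) (begin
    w * w + u * (u + 2 * w)  ≡⟨ square u w ⟩
    (u + w) * (u + w)        ≡⟨ cong (λ t → t * t) (m∸n+n≡m w≤z) ⟩
    z * z                    ≡⟨ cong (z *_) (*-identityʳ z) ⟨
    z ^ 2                    ≡⟨ eq ⟨
    w * w + q ^ n            ∎)
    where
    open ≡-Reasoning
    square : ∀ u w → w * w + u * (u + 2 * w) ≡ (u + w) * (u + w)
    square = solve-∀

  u⊥v : Coprime u v
  u⊥v (c∣u , c∣v) = coprime-^ʳ n 2w⊥q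
    (∣m+n∣m⇒∣n c∣v c∣u , subst (_ ∣_) uv≡qⁿ (∣m⇒∣m*n v c∣u))

-- Parity, logarithms, gaps between odd powers, and residues modulo 7.

even⊎odd : ∀ n → (∃[ m ] n ≡ 2 * m) ⊎ (∃[ m ] n ≡ 2 * m + 1)
even⊎odd zero = inj₁ (0 , refl)
even⊎odd (suc n) with even⊎odd n
... | inj₁ (m , refl) = inj₂ (m , +-comm 1 (2 * m))
... | inj₂ (m , refl) = inj₁ (suc m , eq m)
  where
  eq : ∀ m → suc (2 * m + 1) ≡ 2 * suc m
  eq = solve-∀

2∤2n+1 : ∀ n → 2 ∤ 2 * n + 1
2∤2n+1 n 2∣ with ∣1⇒≡1 (∣m+n∣m⇒∣n 2∣ (m∣m*n n))
... | ()

∣m-n∣≡1⇒consecutive : ∀ m n → ∣ m - n ∣ ≡ 1 → m ≡ suc n ⊎ n ≡ suc m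
∣m-n∣≡1⇒consecutive zero    n       eq = inj₂ eq
∣m-n∣≡1⇒consecutive (suc m) zero    eq = inj₁ eq
∣m-n∣≡1⇒consecutive (suc m) (suc n) eq with ∣m-n∣≡1⇒consecutive m n eq
... | inj₁ refl = inj₁ refl
... | inj₂ refl = inj₂ refl

-- Induction by halving: since `n` is at most twice `⌈ n /2⌉`, the hypothesis passes to `⌈ n /2⌉`,
-- whose logarithm is smaller by one.
2^b<n⇒b<⌈log₂n⌉ : ∀ b n → 2 ^ b < n → b < ⌈log₂ n ⌉
2^b<n⇒b<⌈log₂n⌉ zero    n 1<n = ⌈log₂⌉-mono-≤ 1<n
2^b<n⇒b<⌈log₂n⌉ (suc b) n lt  = m<n∸1⇒1+m<n b
  (subst (b <_) (⌈log₂⌈n/2⌉⌉≡⌈log₂n⌉∸1 n) (2^b<n⇒b<⌈log₂n⌉ b ⌈ n /2⌉ half))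
  where
  m<n∸1⇒1+m<n : ∀ m {n} → m < n ∸ 1 → suc m < n
  m<n∸1⇒1+m<n m {suc n} = s≤s

  open ≤-Reasoning
  half : 2 ^ b < ⌈ n /2⌉
  half = ≰⇒> λ le → <⇒≱ lt (begin
    n                              ≡⟨ ⌊n/2⌋+⌈n/2⌉≡n n ⟨
    _ + ⌈ n /2⌉                    ≤⟨ +-mono-≤ (≤-trans (⌊n/2⌋≤⌈n/2⌉ n) le) le ⟩
    2 ^ b + 2 ^ b                  ≡⟨ cong (2 ^ b +_) (+-identityʳ (2 ^ b)) ⟨
    2 ^ suc b                      ∎)

-- Follows from (d + s)^(2b) ≥ (d (d + s))^b.
odd-power-gap : ∀ d s b →
  d ^ (2 * b + 1) + s * (d * (d + s)) ^ b ≤ (d + s) ^ (2 * b + 1)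
odd-power-gap d s b = begin
  d ^ (2 * b + 1) + s * (d * e) ^ b  ≡⟨ cong₂ (λ m n → m + s * n) (^-odd d b) (^-distribʳ-* d e b) ⟩
  d * (D * D) + s * (D * E)          ≤⟨ +-mono-≤ (*-monoʳ-≤ d (*-mono-≤ D≤E D≤E)) (*-monoʳ-≤ s (*-monoˡ-≤ E D≤E)) ⟩
  d * (E * E) + s * (E * E)          ≡⟨ *-distribʳ-+ (E * E) d s ⟨
  e * (E * E)                        ≡⟨ ^-odd e b ⟨
  e ^ (2 * b + 1)                    ∎
  where
  open ≤-Reasoning
  e D E : ℕ
  e = d + s
  D = d ^ b
  E = e ^ b
  D≤E : D ≤ E
  D≤E = ^-monoˡ-≤ b (m≤m+n d s)

-- 3 is not a square modulo 7, and 9 ^ 3 ≡ 1.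
3*9^c%7≢1 : ∀ c → (3 * 9 ^ c) % 7 ≢ 1
3*9^c%7≢1 0 ()
3*9^c%7≢1 1 ()
3*9^c%7≢1 2 ()
3*9^c%7≢1 (suc (suc (suc c))) eq = 3*9^c%7≢1 c
  (trans (sym ([m+kn]%n≡m%n (3 * 9 ^ c) (312 * 9 ^ c) 7))
         (trans (cong (_% 7) (sym (period (9 ^ c)))) eq))
  where
  period : ∀ m → 3 * (9 * (9 * (9 * m))) ≡ 3 * m + (312 * m) * 7
  period = solve-∀

-- Modulo 7 the left side is 1 once `b` is positive, while the right side is `3 * 9 ^ c`. At
-- `b = 0`, `c = 0` both sides equal 3.
1+2*7^b≢3^odd : ∀ b c → 1 ≤ b → 1 + 2 * 7 ^ b ≢ 3 ^ (2 * c + 1)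
1+2*7^b≢3^odd (suc b) c _ eq = 3*9^c%7≢1 c (begin
  (3 * 9 ^ c) % 7                  ≡⟨ cong (λ t → (3 * t) % 7) (^-distribʳ-* 3 3 c) ⟩
  (3 * (3 ^ c * 3 ^ c)) % 7        ≡⟨ cong (_% 7) (^-odd 3 c) ⟨
  3 ^ (2 * c + 1) % 7              ≡⟨ cong (_% 7) eq ⟨
  (1 + 2 * (7 * 7 ^ b)) % 7        ≡⟨ cong (_% 7) (shift (7 ^ b)) ⟩
  (1 + 2 * 7 ^ b * 7) % 7          ≡⟨ [m+kn]%n≡m%n 1 (2 * 7 ^ b) 7 ⟩
  1                                ∎)
  where
  open ≡-Reasoning
  shift : ∀ m → 1 + 2 * (7 * m) ≡ 1 + 2 * m * 7
  shift = solve-∀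

-- The equation for a fixed odd prime: odd x and even y.

module _ {p : ℕ} (p-prime : Prime p) (2∤p : 2 ∤ p) where

  private
    q : ℕ
    q = 2 * p + 1

    instance
      p≢0 : NonZero p
      p≢0 = prime⇒nonZero p-prime

      q≢0 : NonZero q
      q≢0 = >-nonZero (m≤n+m 1 (2 * p))

  1<p : 1 < p
  1<p = nonTrivial⇒n>1 p {{prime⇒nonTrivial p-prime}}

  2<p : 2 < p
  2<p = ≤∧≢⇒< 1<p λ 2≡p → 2∤p (∣-reflexive 2≡p)

  private
    p<q : p < q
    p<q = subst (p <_) (+-comm 1 (2 * p)) (s≤s (m≤m+n p (p + 0)))

    2⊥q : Coprime 2 q
    2⊥q = coprime-multiple+1 (m∣m*n p)

    p⊥q : Coprime p q
    p⊥q = coprime-multiple+1 (n∣m*n 2 {p})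

    2⊥p : Coprime 2 p
    2⊥p = Coprimality.sym (prime⇒coprime p-prime 2<p)

  p^odd+q^even≢square : ∀ b c z → 1 ≤ b → p ^ (2 * c + 1) + q ^ (2 * b) ≢ z ^ 2
  p^odd+q^even≢square b c z 1≤b eq
    with square-minus-power (q ^ b) z p (2 * c + 1)
           (coprime-* 2⊥p (coprime-^ˡ b (Coprimality.sym p⊥q)))
           (trans (cong (_+ p ^ (2 * c + 1)) (sym (^-even q b)))
             (trans (+-comm (q ^ (2 * b)) _) eq))
  ... | d , e , p≡de , _ , dⁿ+2w≡eⁿ
    with prime⇒irreducible p-prime (divides e (trans p≡de (*-comm d e)))
  -- Here `d = p`, so `e`, a divisor of `p`, is at most `d`, although its power is larger.
  ...   | inj₂ refl = <⇒≱ dⁿ<eⁿ (^-monoˡ-≤ (2 * c + 1) (∣⇒≤ (divides d p≡de)))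
    where
    dⁿ<eⁿ : d ^ (2 * c + 1) < e ^ (2 * c + 1)
    dⁿ<eⁿ = subst (d ^ (2 * c + 1) <_) dⁿ+2w≡eⁿ
      (m<m+n _ (*-mono-≤ (s≤s (z≤n {1})) (m^n>0 q b)))
  ...   | inj₁ refl = 1+2*7^b≢3^odd b c 1≤b
    (subst (λ r → 1 + 2 * (2 * r + 1) ^ b ≡ r ^ (2 * c + 1)) p≡3 1+2qᵇ≡pⁿ)
    where
    1+2qᵇ≡pⁿ : 1 + 2 * q ^ b ≡ p ^ (2 * c + 1)
    1+2qᵇ≡pⁿ = begin
      1 + 2 * q ^ b                ≡⟨ cong (_+ 2 * q ^ b) (^-zeroˡ (2 * c + 1)) ⟨
      1 ^ (2 * c + 1) + 2 * q ^ b  ≡⟨ dⁿ+2w≡eⁿ ⟩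
      e ^ (2 * c + 1)              ≡⟨ cong (_^ (2 * c + 1)) (trans p≡de (*-identityˡ e)) ⟨
      p ^ (2 * c + 1)              ∎
      where open ≡-Reasoning

    -- Modulo `p` the base `q` is 1, so `1 + 2 * q ^ b` leaves 3, while the other side is a positive
    -- power of `p`.
    p∣3 : p ∣ 3
    p∣3 with [m+n]^k≡m^k+n*t 1 (2 * p) b
    ... | t , qᵇ≡1+2pt = ∣m+n∣m⇒∣n (subst (p ∣_) pⁿ≡4pt+3 p∣pⁿ) (m∣m*n (4 * t))
      where
      open ≡-Reasoning
      p∣pⁿ : p ∣ p ^ (2 * c + 1)
      p∣pⁿ = subst (p ∣_) (sym (^-odd p c)) (m∣m*n _)

      collect : ∀ p t → 1 + 2 * (1 + 2 * p * t) ≡ p * (4 * t) + 3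
      collect = solve-∀

      pⁿ≡4pt+3 : p ^ (2 * c + 1) ≡ p * (4 * t) + 3
      pⁿ≡4pt+3 = begin
        p ^ (2 * c + 1)              ≡⟨ 1+2qᵇ≡pⁿ ⟨
        1 + 2 * q ^ b                ≡⟨ cong (λ r → 1 + 2 * r ^ b) (+-comm (2 * p) 1) ⟩
        1 + 2 * (1 + 2 * p) ^ b      ≡⟨ cong (λ r → 1 + 2 * r) qᵇ≡1+2pt ⟩
        1 + 2 * (1 ^ b + 2 * p * t)  ≡⟨ cong (λ r → 1 + 2 * (r + 2 * p * t)) (^-zeroˡ b) ⟩
        1 + 2 * (1 + 2 * p * t)      ≡⟨ collect p t ⟩
        p * (4 * t) + 3              ∎

    p≡3 : p ≡ 3
    p≡3 = ≤-antisym (∣⇒≤ p∣3) 2<p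

  -- Cancelling `p ^ b` leaves `2 ^ b ≤ p`. Equality is impossible because `p` is odd and exceeds 1.
  q^b≤p^a⇒b<⌈log₂p⌉ : ∀ a b → a ≤ suc b → q ^ b ≤ p ^ a → b < ⌈log₂ p ⌉
  q^b≤p^a⇒b<⌈log₂p⌉ a b a≤1+b qᵇ≤pᵃ = 2^b<n⇒b<⌈log₂n⌉ b p (≤∧≢⇒< 2ᵇ≤p (2ᵇ≢p b))
    where
    open ≤-Reasoning
    2ᵇ≤p : 2 ^ b ≤ p
    2ᵇ≤p = *-cancelʳ-≤ (2 ^ b) p (p ^ b) {{m^n≢0 p b}} (begin
      2 ^ b * p ^ b  ≡⟨ ^-distribʳ-* 2 p b ⟨
      (2 * p) ^ b    ≤⟨ ^-monoˡ-≤ b (m≤m+n (2 * p) 1) ⟩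
      q ^ b          ≤⟨ qᵇ≤pᵃ ⟩
      p ^ a          ≤⟨ ^-monoʳ-≤ p a≤1+b ⟩
      p * p ^ b      ∎)

    2ᵇ≢p : ∀ b → 2 ^ b ≢ p
    2ᵇ≢p zero    1≡p = <-irrefl 1≡p 1<p
    2ᵇ≢p (suc b) eq  = 2∤p (subst (2 ∣_) eq (m∣m*n (2 ^ b)))

  -- Even x and odd y: the factorization of q into d and d + s.

  module _ (a b d s : ℕ) (q≡d[d+s] : q ≡ d * (d + s))
           (dⁿ+2pᵃ≡[d+s]ⁿ : d ^ (2 * b + 1) + 2 * p ^ a ≡ (d + s) ^ (2 * b + 1)) where

    -- This is `odd-power-gap` with the power of `d` cancelled. It serves twice: with `s = 2 * p` it
    -- forces `b = 0`, and with `s = 2` it bounds `b`.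
    gap : s * q ^ b ≤ 2 * p ^ a
    gap = +-cancelˡ-≤ (d ^ (2 * b + 1)) _ _
      (subst (λ r → d ^ (2 * b + 1) + s * r ^ b ≤ d ^ (2 * b + 1) + 2 * p ^ a) (sym q≡d[d+s])
        (subst (d ^ (2 * b + 1) + s * (d * (d + s)) ^ b ≤_) (sym dⁿ+2pᵃ≡[d+s]ⁿ)
          (odd-power-gap d s b)))

    -- Now `s = 2 * p`, so `gap` reduces to `q ^ b ≤ p ^ b`, which fails for positive `b` since
    -- `p < q`.
    d≡1⇒b≡0 : a ≤ suc b → d ≡ 1 → b ≡ 0
    d≡1⇒b≡0 a≤1+b refl = b≡0 b qᵇ≤pᵇ
      where
      open ≤-Reasoning
      s≡2p : s ≡ 2 * p
      s≡2p = suc-injective (trans (sym (*-identityˡ (suc s)))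
        (trans (sym q≡d[d+s]) (+-comm (2 * p) 1)))

      qᵇ≤pᵇ : q ^ b ≤ p ^ b
      qᵇ≤pᵇ = *-cancelˡ-≤ (2 * p) {{m*n≢0 2 p}} (begin
        2 * p * q ^ b    ≡⟨ cong (_* q ^ b) s≡2p ⟨
        s * q ^ b        ≤⟨ gap ⟩
        2 * p ^ a        ≤⟨ *-monoʳ-≤ 2 (^-monoʳ-≤ p a≤1+b) ⟩
        2 * (p * p ^ b)  ≡⟨ *-assoc 2 p (p ^ b) ⟨
        2 * p * p ^ b    ∎)

      b≡0 : ∀ b → q ^ b ≤ p ^ b → b ≡ 0
      b≡0 zero    _  = refl
      b≡0 (suc b) le = contradiction le (<⇒≱ (^-monoˡ-< (suc b) p<q))

    d-odd : ∃[ m ] d ≡ 2 * m + 1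
    d-odd with even⊎odd d
    ... | inj₂ odd         = odd
    ... | inj₁ (m , d≡2m) = contradiction
      (subst (2 ∣_) (sym q≡d[d+s]) (∣m⇒∣m*n (d + s) (subst (2 ∣_) (sym d≡2m) (m∣m*n m))))
      (2∤2n+1 p)

    -- s divides 2pᵃ, it is even since d and d + s are odd, and s / 2 < p.
    1<d⇒s≡2 : 1 < d → s ≡ 2
    1<d⇒s≡2 1<d with even⊎odd s
    ... | inj₂ (l , s≡2l+1) =
      let m , d≡2m+1 = d-odd in contradiction
        (subst (2 ∣_) (sym q≡d[d+s]) (∣n⇒∣m*n d
          (subst (2 ∣_) (sym (trans (cong₂ _+_ d≡2m+1 s≡2l+1) (even m l))) (m∣m*n (m + l + 1)))))
        (2∤2n+1 p)
      where
      even : ∀ m l → 2 * m + 1 + (2 * l + 1) ≡ 2 * (m + l + 1)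
      even = solve-∀
    ... | inj₁ (l , refl) = cong (2 *_) l≡1
      where
      l∣pᵃ : l ∣ p ^ a
      l∣pᵃ with [m+n]^k≡m^k+n*t d (2 * l) (2 * b + 1)
      ... | t , eq = divides t (*-cancelˡ-≡ (p ^ a) (t * l) 2
        (trans (+-cancelˡ-≡ (d ^ (2 * b + 1)) _ _ (trans dⁿ+2pᵃ≡[d+s]ⁿ eq))
               (trans (*-assoc 2 l t) (cong (2 *_) (*-comm l t)))))

      instance
        l≢0 : NonZero l
        l≢0 = ≢-nonZero λ { refl → <-irrefl (sym (0∣⇒≡0 l∣pᵃ)) (m^n>0 p a) }

      -- As `1 < d`, the factor `d + 2 * l` of `2 * p + 1` is a proper one, and it is already at
      -- least `1 + 2 * l`.
      l<p : l < p
      l<p = *-cancelˡ-< 2 l p (s≤s⁻¹ (begin-strict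
        suc (2 * l)    ≤⟨ +-monoˡ-≤ (2 * l) (<⇒≤ 1<d) ⟩
        d + 2 * l      <⟨ m<m*n (d + 2 * l) d {{>-nonZero (≤-trans (<⇒≤ 1<d) (m≤m+n d _))}} 1<d ⟩
        (d + 2 * l) * d ≡⟨ *-comm (d + 2 * l) d ⟩
        d * (d + 2 * l) ≡⟨ q≡d[d+s] ⟨
        2 * p + 1      ≡⟨ +-comm (2 * p) 1 ⟩
        suc (2 * p)    ∎))
        where open ≤-Reasoning

      l≡1 : l ≡ 1
      l≡1 = coprime-^ˡ a (prime⇒coprime p-prime l<p) (l∣pᵃ , ∣-refl)

    d≡1⊎consecutive : 1 ≤ a → a ≤ suc b →
      (a ≡ 1 × b ≡ 0 × d ≡ 1) ⊎ ∃[ m ] (1 ≤ m × d ≡ 2 * m + 1 × s ≡ 2)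
    d≡1⊎consecutive 1≤a a≤1+b with d-odd
    ... | zero  , d≡1 =
      let b≡0 = d≡1⇒b≡0 a≤1+b d≡1
      in inj₁ (≤-antisym (subst (λ b → a ≤ suc b) b≡0 a≤1+b) 1≤a , b≡0 , d≡1)
    ... | m@(suc _) , d≡2m+1 =
      inj₂ (m , s≤s z≤n , d≡2m+1 , 1<d⇒s≡2 (subst (1 <_) (sym d≡2m+1) (m<n+m 1 {2 * m} (s≤s z≤n))))

  p^even+q^odd≡square⇒ : ∀ a b z → 1 ≤ a → a ≤ suc b → p ^ (2 * a) + q ^ (2 * b + 1) ≡ z ^ 2 →
    (a ≡ 1 × b ≡ 0 × z ≡ p + 1)
    ⊎ ∃[ k ] ( 2 ≤ k × p ≡ 2 * k ^ 2 ∸ 1 × q ≡ (2 * k ∸ 1) * (2 * k + 1)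
             × (2 * k + 1) ^ (2 * b + 1) ∸ (2 * k ∸ 1) ^ (2 * b + 1) ≡ 2 * p ^ a
             × b < ⌈log₂ p ⌉)
  p^even+q^odd≡square⇒ a b z 1≤a a≤1+b eq
    with square-minus-power (p ^ a) z q (2 * b + 1)
           (coprime-* 2⊥q (coprime-^ˡ a p⊥q))
           (trans (cong (_+ q ^ (2 * b + 1)) (sym (^-even p a))) eq)
  ... | d , e , q≡de , z≡dⁿ+w , dⁿ+2w≡eⁿ
    -- The larger power has the larger base, so `e` can be written as `d + s`.
    with m≤n⇒∃[o]m+o≡n (<⇒≤ (^-reflects-< d e (2 * b + 1)
           (subst (d ^ (2 * b + 1) <_) dⁿ+2w≡eⁿ
             (m<m+n _ (*-mono-≤ (s≤s (z≤n {1})) (m^n>0 p a))))))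
  ... | s , refl with d≡1⊎consecutive a b d s q≡de dⁿ+2w≡eⁿ 1≤a a≤1+b
  ...   | inj₁ (refl , refl , refl) =
    inj₁ (refl , refl , trans z≡dⁿ+w (trans (+-comm 1 (p * 1)) (cong (_+ 1) (*-identityʳ p))))
  -- The witness is `k = m + 1`, so that `d = 2 * m + 1` is `2 * k ∸ 1` and `d + 2` is `2 * k + 1`.
  ...   | inj₂ (m , 1≤m , refl , refl) = inj₂ (suc m , s≤s 1≤m , p≡2k²∸1
    , trans q≡de (cong₂ _*_ (sym 2k∸1≡d) (sym (2k+1≡d+2 m)))
    , trans (cong₂ (λ i j → i ^ (2 * b + 1) ∸ j ^ (2 * b + 1)) (2k+1≡d+2 m) 2k∸1≡d)
        (trans (cong (_∸ d ^ (2 * b + 1)) (sym dⁿ+2w≡eⁿ)) (m+n∸m≡n (d ^ (2 * b + 1)) _))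
    , q^b≤p^a⇒b<⌈log₂p⌉ a b a≤1+b (*-cancelˡ-≤ {q ^ b} {p ^ a} 2 (gap a b d 2 q≡de dⁿ+2w≡eⁿ)))
    where
    2k≡1+d : ∀ m → 2 * suc m ≡ 1 + (2 * m + 1)
    2k≡1+d = solve-∀

    2k∸1≡d : 2 * suc m ∸ 1 ≡ d
    2k∸1≡d = cong (_∸ 1) (2k≡1+d m)

    2k+1≡d+2 : ∀ m → 2 * suc m + 1 ≡ 2 * m + 1 + 2
    2k+1≡d+2 = solve-∀

    1+de≡2[2k²] : ∀ m → 1 + (2 * m + 1) * (2 * m + 1 + 2) ≡ 2 * (2 * (suc m * (suc m * 1)))
    1+de≡2[2k²] = solve-∀

    -- Both `2 * (p + 1)` and `4 * k ^ 2` equal `1 + q`; halve and subtract 1.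
    p≡2k²∸1 : p ≡ 2 * suc m ^ 2 ∸ 1
    p≡2k²∸1 = cong (_∸ 1) (*-cancelˡ-≡ (suc p) (2 * suc m ^ 2) 2
      (trans (2[1+p]≡1+q p) (trans (cong suc q≡de) (1+de≡2[2k²] m))))
      where
      2[1+p]≡1+q : ∀ p → 2 * suc p ≡ suc (2 * p + 1)
      2[1+p]≡1+q = solve-∀

  -- Compositeness, coprimality, and disjointness of the two cases.

  module _ {k : ℕ} (2≤k : 2 ≤ k) (q≡[2k∸1][2k+1] : q ≡ (2 * k ∸ 1) * (2 * k + 1)) where

    private
      2<2k∸1 : 2 < 2 * k ∸ 1
      2<2k∸1 = ∸-monoˡ-≤ 1 (*-monoʳ-≤ 2 2≤k)

      2k∸1∣q : 2 * k ∸ 1 ∣ q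
      2k∸1∣q = subst (2 * k ∸ 1 ∣_) (sym q≡[2k∸1][2k+1]) (m∣m*n (2 * k + 1))

    composite-q : Composite q
    composite-q = composite
      (subst (2 * k ∸ 1 <_) (sym q≡[2k∸1][2k+1])
        (m<m*n _ (2 * k + 1) {{>-nonZero (≤-trans (s≤s z≤n) 2<2k∸1)}} 1<2k+1))
      2k∸1∣q
      where
      instance _ = n>1⇒nonTrivial (<⇒≤ 2<2k∸1)

      1<2k+1 : 1 < 2 * k + 1
      1<2k+1 = ≤-trans (<⇒≤ 2<2k∸1) (≤-trans (m∸n≤m (2 * k) 1) (m≤m+n (2 * k) 1))

    -- A common divisor divides the difference 2 and also the odd number `q`.
    gcd[2k∸1,2k+1]≡1 : gcd (2 * k ∸ 1) (2 * k + 1) ≡ 1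
    gcd[2k∸1,2k+1]≡1 = coprime⇒gcd≡1 λ {c} (c∣2k∸1 , c∣2k+1) →
      2⊥q (∣m+n∣m⇒∣n (subst (c ∣_) 2k+1≡2k∸1+2 c∣2k+1) c∣2k∸1 , ∣-trans c∣2k∸1 2k∸1∣q)
      where
      1≤2k : 1 ≤ 2 * k
      1≤2k = ≤-trans (s≤s z≤n) (≤-trans 2<2k∸1 (m∸n≤m (2 * k) 1))

      2k+1≡2k∸1+2 : 2 * k + 1 ≡ 2 * k ∸ 1 + 2
      2k+1≡2k∸1+2 = trans (cong (_+ 1) (sym (m∸n+n≡m 1≤2k))) (+-assoc (2 * k ∸ 1) 1 1)

  -- The exponents of case (i) force `a = 1` and `b = 0`, so the left side is at most 2 and the
  -- right side is `2 * p`. Only a bound is proved, as truncation gives 1 at `k = 0`.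
  2≡2a⇒1≡2b+1⇒no-solution : ∀ k a b → 2 ≡ 2 * a → 1 ≡ 2 * b + 1 →
    (2 * k + 1) ^ (2 * b + 1) ∸ (2 * k ∸ 1) ^ (2 * b + 1) ≢ 2 * p ^ a
  2≡2a⇒1≡2b+1⇒no-solution k a b 2≡2a 1≡2b+1 eq
    with *-cancelˡ-≡ 1 a 2 2≡2a | *-cancelˡ-≡ 0 b 2 (+-cancelʳ-≡ 1 0 (2 * b) 1≡2b+1)
  ... | refl | refl = <⇒≱ 2<2p (subst (_≤ 2) eq (m≤n+o⇒m∸n≤o _ _ (begin
    (2 * k + 1) ^ 1          ≡⟨ *-identityʳ (2 * k + 1) ⟩
    2 * k + 1                ≤⟨ +-monoˡ-≤ 1 (m≤n+m∸n (2 * k) 1) ⟩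
    1 + (2 * k ∸ 1) + 1      ≡⟨ cong (_+ 1) (+-comm 1 (2 * k ∸ 1)) ⟩
    2 * k ∸ 1 + 1 + 1        ≡⟨ +-assoc (2 * k ∸ 1) 1 1 ⟩
    2 * k ∸ 1 + 2            ≡⟨ cong (_+ 2) (*-identityʳ (2 * k ∸ 1)) ⟨
    (2 * k ∸ 1) ^ 1 + 2      ∎)))
    where
    open ≤-Reasoning
    2<2p : 2 < 2 * p ^ 1
    2<2p = *-monoʳ-< 2 (subst (1 <_) (sym (*-identityʳ p)) 1<p)

-- Parities of the exponents and assembly of the theorem.

consecutive-even : ∀ b x → x ≡ suc (2 * b) ⊎ 2 * b ≡ suc x → ∃[ c ] x ≡ 2 * c + 1
consecutive-even b       x (inj₁ x≡1+2b) = b , trans x≡1+2b (+-comm 1 (2 * b))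
consecutive-even (suc b) x (inj₂ 2b≡1+x) = b , suc-injective (trans (sym 2b≡1+x) (eq b))
  where
  eq : ∀ b → 2 * suc b ≡ suc (2 * b + 1)
  eq = solve-∀

-- The bound on `a` is the form in which closeness of the exponents enters the size estimates.
consecutive-odd : ∀ b x → x ≡ suc (2 * b + 1) ⊎ 2 * b + 1 ≡ suc x → ∃[ a ] x ≡ 2 * a × a ≤ suc b
consecutive-odd b x (inj₁ x≡2b+2) = suc b , trans x≡2b+2 (eq b) , ≤-refl
  where
  eq : ∀ b → suc (2 * b + 1) ≡ 2 * suc b
  eq = solve-∀
consecutive-odd b x (inj₂ 2b+1≡1+x) =
  b , suc-injective (trans (sym 2b+1≡1+x) (+-comm (2 * b) 1)) , n≤1+n b

odd-even⊎even-odd : ∀ x y → ∣ x - y ∣ ≡ 1 →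
  (∃[ b ] ∃[ c ] x ≡ 2 * c + 1 × y ≡ 2 * b)
  ⊎ (∃[ a ] ∃[ b ] x ≡ 2 * a × y ≡ 2 * b + 1 × a ≤ suc b)
odd-even⊎even-odd x y ∣x-y∣≡1 with even⊎odd y | ∣m-n∣≡1⇒consecutive x y ∣x-y∣≡1
... | inj₁ (b , refl) | near = let c , x≡2c+1 = consecutive-even b x near in
  inj₁ (b , c , x≡2c+1 , refl)
... | inj₂ (b , refl) | near = let a , x≡2a , a≤1+b = consecutive-odd b x near in
  inj₂ (a , b , x≡2a , refl , a≤1+b)

theorem1 : ∀ (p x y z : ℕ) → Prime p → 2 ∤ p →
    1 ≤ x → 1 ≤ y → 1 ≤ z →
    ∣ x - y ∣ ≡ 1 →
    p ^ x + (2 * p + 1) ^ y ≡ z ^ 2 →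
    ExactlyOne
    (x ≡ 2 × y ≡ 1 × z ≡ p + 1)
    (Composite (2 * p + 1) ×
    (∃[ k ] ∃[ a ] ∃[ b ]
    ( 2 ≤ k × 1 ≤ a × 0 ≤ b
    × x ≡ 2 * a
    × y ≡ 2 * b + 1
    × p ≡ 2 * k ^ 2 ∸ 1
    × 2 * p + 1 ≡ (2 * k ∸ 1) * (2 * k + 1)
    × gcd (2 * k ∸ 1) (2 * k + 1) ≡ 1
    × (2 * k + 1) ^ (2 * b + 1) ∸ (2 * k ∸ 1) ^ (2 * b + 1) ≡ 2 * (2 * k ^ 2 ∸ 1) ^ a
    × b < ⌈log₂ (2 * k ^ 2 ∸ 1) ⌉)))
theorem1 p x y z p-prime 2∤p 1≤x 1≤y _ ∣x-y∣≡1 eq =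
  [ odd-even , even-odd ] (odd-even⊎even-odd x y ∣x-y∣≡1) , exclusive
  where
  exclusive : ¬ (_ × _)
  exclusive ((x≡2 , y≡1 , _) , _ , k , a , b , _ , _ , _ , x≡2a , y≡2b+1 , p≡ , _ , _ , eq′ , _) =
    2≡2a⇒1≡2b+1⇒no-solution p-prime 2∤p k a b (trans (sym x≡2) x≡2a) (trans (sym y≡1) y≡2b+1)
      (trans eq′ (cong (λ r → 2 * r ^ a) (sym p≡)))

  at : ∀ {m n} → x ≡ m → y ≡ n → p ^ m + (2 * p + 1) ^ n ≡ z ^ 2
  at refl refl = eq

  odd-even : _ → _ ⊎ _
  odd-even (b , c , x≡2c+1 , y≡2b) = contradiction (at x≡2c+1 y≡2b)
    (p^odd+q^even≢square p-prime 2∤p b c z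
      -- The bound `1 ≤ 2 * b` is by definition `2 * 0 < 2 * b`.
      (*-cancelˡ-< 2 0 b (subst (1 ≤_) y≡2b 1≤y)))

  even-odd : _ → _ ⊎ _
  even-odd (a , b , x≡2a , y≡2b+1 , a≤1+b) =
    [ (λ (a≡1 , b≡0 , z≡p+1) → inj₁
        ( trans x≡2a (cong (2 *_) a≡1)
        , trans y≡2b+1 (cong (λ b → 2 * b + 1) b≡0)
        , z≡p+1))
    , (λ (k , 2≤k , p≡ , q≡ , eq′ , b<log) → inj₂
        ( composite-q p-prime 2∤p 2≤k q≡
        , k , a , b , 2≤k , 1≤a , z≤n , x≡2a , y≡2b+1 , p≡ , q≡
        , gcd[2k∸1,2k+1]≡1 p-prime 2∤p 2≤k q≡
        , trans eq′ (cong (λ r → 2 * r ^ a) p≡)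
        , subst (λ r → b < ⌈log₂ r ⌉) p≡ b<log))
    ] (p^even+q^odd≡square⇒ p-prime 2∤p a b z 1≤a a≤1+b (at x≡2a y≡2b+1))
    where
    1≤a : 1 ≤ a
    1≤a = *-cancelˡ-< 2 0 a (subst (1 ≤_) x≡2a 1≤x)
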